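{- Let $m,n\ge 1$ be integers and consider the warden's game played with $n$ dice, each with $m$ sides. Then there is exactly one position of each remoteness from $0$ to $m^n$, and the position with the largest remoteness $m^n$ is the position of all $(m-1)$'s. Here the goal position (all $(m-1)$'s) is counted both as an ending position, with remoteness $0$, and as a starting position, with positive remoteness. Equivalently: for every integer $j$ with $1\le j\le m^n$ there is exactly one position $\beta$ with $r(\beta)=j$, and the goal position $\gamma$ satisfies $r(\gamma)=m^n$.
   Context: The warden's game with $n$ $m$-sided dice: a position is a string $x_1x_2\ldots x_n$ with each $x_i\in\{0,1,\ldots,m-1\}$. There are two players, the prisoner and the warden, both with full information. In each move the rightmost die is transferred to the far left, possibly with a changed value, so that $x_1\ldots x_n$ becomes $c\,x_1\ldots x_{n-1}$ for some $c$ determined as follows. The warden first chooses either (i) to transfer the die himself, strictly decreasing its value, i.e. he chooses any $c$ with $0\le c<x_n$ (impossible if $x_n=0$), or (ii) to pass, in which case the prisoner must transfer the die and chooses any $c$ with $x_n\le c\le m-1$. The prisoner wins when the goal position, consisting of all $(m-1)$'s, is reached. Remoteness: $r(\beta)$ is the number of moves the game lasts starting from position $\beta$ when the prisoner tries to win as quickly as possible and the warden tries to delay the prisoner's win as long as possible. That is, $r(\beta)$ is the least $k\ge 1$ such that the prisoner has a strategy guaranteeing that, starting from $\beta$, the goal position is reached after some number $t$ of moves with $1\le t\le k$. In particular, when $\beta$ is the goal position itself, $r(\beta)$ denotes its remoteness as a starting position (the prisoner wins once the goal position is reached again after at least one move), so $r(\beta)>0$. As an ending position, the goal position is the only position of remoteness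 $0$. -}

module Defs where

open import Data.Fin as Fin using (Fin; fromℕ)
open import Data.List.NonEmpty using (List⁺; [_]; _∷⁺_; head)
open import Data.Nat using (ℕ; zero; suc; _≤_)
open import Data.Product using (Σ-syntax; ∃-syntax; _×_; proj₁)
open import Data.Vec using (Vec; _∷_; init; last; replicate)
open import Relation.Binary.PropositionalEquality using (_≡_)

private variable
  m n : ℕ

-- n dice with m sides, the string x₁x₂…xₙ being x₁ ∷ x₂ ∷ … ∷ xₙ ∷ [].
Position : ℕ → ℕ → Set
Position m n = Vec (Fin m) n

goal : Position (suc m) n
goal {m} {n} = replicate n (fromℕ m)

-- x₁…xₙ becomes c x₁…xₙ₋₁.
transfer : Fin m → Position m (suc n) → Position m (suc n)
transfer c x = c ∷ init x

data WardenChoice (x : Position m (suc n)) : Set where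
  decrease : (c : Fin m) → c Fin.< last x → WardenChoice x
  pass     : WardenChoice x

PrisonerChoice : Position m (suc n) → Set
PrisonerChoice {m} x = Σ[ c ∈ Fin m ] last x Fin.≤ c

-- The positions visited so far, most recent first. They determine who made
-- each transfer, so a history carries all the information the players have.
History : ℕ → ℕ → Set
History m n = List⁺ (Position m n)

WardenStrategy : ℕ → ℕ → Set
WardenStrategy m n = (h : History m (suc n)) → WardenChoice (head h)

-- Consulted only when the warden passes.
PrisonerStrategy : ℕ → ℕ → Set
PrisonerStrategy m n = (h : History m (suc n)) → PrisonerChoice (head h)

step : (x : Position m (suc n)) → WardenChoice x → PrisonerChoice x →
       Position m (suc n)
step x (decrease c _) _ = transfer c x
step x pass           p = transfer (proj₁ p) x

-- The history after t moves. Play is continued past the goal position; this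
-- is harmless, as only whether the goal has been reached by a given move matters.
play : PrisonerStrategy m n → WardenStrategy m n → Position m (suc n) →
       ℕ → History m (suc n)
play σ τ β zero    = [ β ]
play σ τ β (suc t) = let h = play σ τ β t in step (head h) (τ h) (σ h) ∷⁺ h

WinsWithin : ℕ → Position (suc m) (suc n) → Set
WinsWithin {m} {n} k β =
  Σ[ σ ∈ PrisonerStrategy (suc m) n ] ((τ : WardenStrategy (suc m) n) →
    ∃[ t ] 1 ≤ t × t ≤ k × head (play σ τ β t) ≡ goal)

record StartRemoteness (β : Position (suc m) (suc n)) (k : ℕ) : Set where
  field
    positive : 1 ≤ k
    wins     : WinsWithin k β
    least    : ∀ k′ → 1 ≤ k′ → WinsWithin k′ β → k ≤ k′

-- A relation rather than a function: the goal position has remoteness 0 as an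
-- ending position and also a positive remoteness as a starting position.
data Remoteness {m n : ℕ} : Position (suc m) (suc n) → ℕ → Set where
  ending   : Remoteness goal 0
  starting : ∀ {β k} → StartRemoteness β k → Remoteness β k

{-# OPTIONS --safe #-}
module Submission where

-- Let W k be the set of positions from which the prisoner can win within k
-- moves, and G k = W k ∪ {goal}. Then wa is in W (k+1) iff cw is in G k for all
-- c < a and for some c ≥ a. Lowering dice that do not show m-1 preserves G k, so
-- {c : cw ∈ G k} is an initial segment, possibly together with m-1, and it has as
-- many elements as {a : wa ∈ W (k+1)}. Summing over w gives |W (k+1)| = |G k|.
-- The goal lies in W k only if every position does, so |W k| = k for k ≤ mⁿ.
-- The position of remoteness k+1 is the one in W (k+1) but not in W k.

open import Data.Bool using (if_then_else_)
open import Data.Empty using (⊥)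
open import Data.Fin as Fin using (Fin; zero; suc; fromℕ)
import Data.Fin.Properties as Fin
open import Data.List as List using (List; []; _∷_)
open import Data.List.NonEmpty using (head; tail)
open import Data.Nat
open import Data.Nat.Properties
open import Data.Product using (∃; ∃!; ∃-syntax; _×_; _,_; proj₁; proj₂)
open import Data.Sum using (_⊎_; inj₁; inj₂; [_,_]′)
open import Data.Vec using ([]; _∷_; _∷ʳ_; init; last; toList)
open import Data.Vec.Properties
  using (init-∷ʳ; last-∷ʳ; ≡-dec; length-toList; ∷-injectiveˡ; ∷-injectiveʳ)
open import Data.Vec.Relation.Binary.Pointwise.Inductive as Pointwise
  using (Pointwise; []; _∷_)
open import Function using (_∘_; id; case_of_)
open import Relation.Binary.PropositionalEquality
open import Relation.Nullary
open import Relation.Unary using (Decidable)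
open import Defs
open import Algebra.Properties.CommutativeMonoid.Sum +-0-commutativeMonoid
  using (sum; sum-cong-≗; sum-replicate-zero; ∑-distrib-+; ∑-comm)

private variable
  m n : ℕ
  A B C : Set

-- Indicators of decisions.

𝟙 : Dec A → ℕ
𝟙 a? = if does a? then 1 else 0

𝟙-true : (a? : Dec A) → A → 𝟙 a? ≡ 1
𝟙-true (yes _) _ = refl
𝟙-true (no ¬a) a = contradiction a ¬a

𝟙-false : (a? : Dec A) → ¬ A → 𝟙 a? ≡ 0
𝟙-false (yes a) ¬a = contradiction a ¬a
𝟙-false (no _)  _  = refl

𝟙≡1⇒ : (a? : Dec A) → 𝟙 a? ≡ 1 → A
𝟙≡1⇒ (yes a) _ = a

𝟙≡0⇒ : (a? : Dec A) → 𝟙 a? ≡ 0 → ¬ A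
𝟙≡0⇒ (no ¬a) _ = ¬a

𝟙-cong : (a? : Dec A) (b? : Dec B) → (A → B) → (B → A) → 𝟙 a? ≡ 𝟙 b?
𝟙-cong (yes a) b? f _ = sym (𝟙-true b? (f a))
𝟙-cong (no ¬a) b? _ g = sym (𝟙-false b? (¬a ∘ g))

𝟙-⊎ : (a? : Dec A) (b? : Dec B) (c? : Dec C) →
      (C → A ⊎ B) → (A → C) → (B → C) → (A → ¬ B) → 𝟙 c? ≡ 𝟙 a? + 𝟙 b?
𝟙-⊎ (yes a) (yes b) c? _ _ _ h = contradiction b (h a)
𝟙-⊎ (yes a) (no _)  c? _ f _ _ = 𝟙-true c? (f a)
𝟙-⊎ (no _)  (yes b) c? _ _ g _ = 𝟙-true c? (g b)
𝟙-⊎ (no ¬a) (no ¬b) c? s _ _ _ = 𝟙-false c? ([ ¬a , ¬b ]′ ∘ s)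

-- Sums over faces.

sum-const : ∀ n k → sum {n} (λ _ → k) ≡ n * k
sum-const zero    k = refl
sum-const (suc n) k = cong (k +_) (sum-const n k)

sum-zero : {f : Fin n → ℕ} → (∀ i → f i ≡ 0) → sum f ≡ 0
sum-zero {n} f≡0 = trans (sum-cong-≗ f≡0) (sum-replicate-zero n)

sum≡0⇒ : (f : Fin n → ℕ) → sum f ≡ 0 → ∀ i → f i ≡ 0
sum≡0⇒ f eq zero    = m+n≡0⇒m≡0 _ eq
sum≡0⇒ f eq (suc i) = sum≡0⇒ (f ∘ suc) (m+n≡0⇒n≡0 (f zero) eq) i

SinglePoint : {I : Set} → (I → ℕ) → I → Set
SinglePoint f i = f i ≡ 1 × (∀ j → j ≢ i → f j ≡ 0)

sum-point : {f : Fin n → ℕ} (i : Fin n) → SinglePoint f i → sum f ≡ 1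
sum-point zero (one , rest) =
  cong₂ _+_ one (sum-zero λ j → rest (suc j) λ ())
sum-point (suc i) (one , rest) =
  cong₂ _+_ (rest zero λ ())
    (sum-point i (one , λ j j≢i → rest (suc j) (j≢i ∘ Fin.suc-injective)))

sum≡1⇒ : (f : Fin n → ℕ) → sum f ≡ 1 → ∃ (SinglePoint f)
sum≡1⇒ {suc n} f eq with f zero in eq₀
... | 0 =
  let i , one , rest = sum≡1⇒ (f ∘ suc) eq in
  suc i , one , λ { zero _ → eq₀ ; (suc j) j≢i → rest j (j≢i ∘ cong suc) }
... | 1 =
  zero , eq₀ , λ
    { zero j≢0 → contradiction refl j≢0
    ; (suc j) _ → sum≡0⇒ (f ∘ suc) (suc-injective eq) j }
... | suc (suc _) = case eq of λ ()

-- Sums over positions.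

∑ᵖ : (Position m n → ℕ) → ℕ
∑ᵖ {n = zero}  f = f []
∑ᵖ {n = suc n} f = sum λ c → ∑ᵖ (f ∘ (c ∷_))

∑ᵖ-cong : {f g : Position m n → ℕ} → f ≗ g → ∑ᵖ f ≡ ∑ᵖ g
∑ᵖ-cong {n = zero}  f≗g = f≗g []
∑ᵖ-cong {n = suc n} f≗g = sum-cong-≗ λ c → ∑ᵖ-cong (f≗g ∘ (c ∷_))

∑ᵖ-distrib-+ : (f g : Position m n → ℕ) →
               ∑ᵖ (λ x → f x + g x) ≡ ∑ᵖ f + ∑ᵖ g
∑ᵖ-distrib-+ {n = zero}  f g = refl
∑ᵖ-distrib-+ {n = suc n} f g =
  trans (sum-cong-≗ λ c → ∑ᵖ-distrib-+ (f ∘ (c ∷_)) (g ∘ (c ∷_)))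
        (∑-distrib-+ (λ c → ∑ᵖ (f ∘ (c ∷_))) (λ c → ∑ᵖ (g ∘ (c ∷_))))

∑ᵖ-one : ∀ m n → ∑ᵖ {m} {n} (λ _ → 1) ≡ m ^ n
∑ᵖ-one m zero    = refl
∑ᵖ-one m (suc n) = trans (sum-cong-≗ {m} λ _ → ∑ᵖ-one m n) (sum-const m (m ^ n))

∑ᵖ-zero : {f : Position m n → ℕ} → (∀ x → f x ≡ 0) → ∑ᵖ f ≡ 0
∑ᵖ-zero {n = zero}  f≡0 = f≡0 []
∑ᵖ-zero {n = suc n} f≡0 = sum-zero λ c → ∑ᵖ-zero (f≡0 ∘ (c ∷_))

∑ᵖ≡0⇒ : (f : Position m n → ℕ) → ∑ᵖ f ≡ 0 → ∀ x → f x ≡ 0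
∑ᵖ≡0⇒ f eq []      = eq
∑ᵖ≡0⇒ f eq (c ∷ w) = ∑ᵖ≡0⇒ (f ∘ (c ∷_)) (sum≡0⇒ _ eq c) w

∑ᵖ-point : {f : Position m n → ℕ} (x : Position m n) →
           SinglePoint f x → ∑ᵖ f ≡ 1
∑ᵖ-point []      (one , _)    = one
∑ᵖ-point (c ∷ w) (one , rest) = sum-point c
  ( ∑ᵖ-point w (one , λ v v≢w → rest (c ∷ v) (v≢w ∘ ∷-injectiveʳ))
  , λ d d≢c → ∑ᵖ-zero λ v → rest (d ∷ v) (d≢c ∘ ∷-injectiveˡ))

∑ᵖ≡1⇒ : (f : Position m n → ℕ) → ∑ᵖ f ≡ 1 → ∃ (SinglePoint f)
∑ᵖ≡1⇒ {n = zero}  f eq = [] , eq , λ { [] x≢[] → contradiction refl x≢[] }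
∑ᵖ≡1⇒ {n = suc n} f eq =
  let c , one , rest  = sum≡1⇒ (λ c → ∑ᵖ (f ∘ (c ∷_))) eq
      w , one′ , rest′ = ∑ᵖ≡1⇒ (f ∘ (c ∷_)) one
  in c ∷ w , one′ , λ where
       (d ∷ v) ≢cw → case d Fin.≟ c of λ where
         (yes refl) → rest′ v (≢cw ∘ cong (c ∷_))
         (no d≢c)   → ∑ᵖ≡0⇒ (f ∘ (d ∷_)) (rest d d≢c) v

-- `∑ᵖ` recurses on the first die, whereas a move consumes the last one; peeling from this end
-- groups positions by the dice that a move keeps.
∑ᵖ-∷ʳ : (f : Position m (suc n) → ℕ) →
        ∑ᵖ f ≡ ∑ᵖ λ w → sum λ a → f (w ∷ʳ a)
∑ᵖ-∷ʳ {n = zero}  f = refl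
∑ᵖ-∷ʳ {n = suc n} f = sum-cong-≗ λ c → ∑ᵖ-∷ʳ (f ∘ (c ∷_))

sum-∑ᵖ-comm : ∀ {l} (g : Fin l → Position m n → ℕ) →
              sum (λ c → ∑ᵖ (g c)) ≡ ∑ᵖ λ w → sum λ c → g c w
sum-∑ᵖ-comm {n = zero}  g = refl
sum-∑ᵖ-comm {n = suc n} g =
  trans (∑-comm λ c d → ∑ᵖ (g c ∘ (d ∷_)))
        (sum-cong-≗ λ d → sum-∑ᵖ-comm λ c → g c ∘ (d ∷_))

count : {P : Position m n → Set} → Decidable P → ℕ
count P? = ∑ᵖ (𝟙 ∘ P?)

-- Faces from which one move forces a set of faces.

Forces : (Fin m → Set) → Fin m → Set
Forces P a = (∀ c → c Fin.< a → P c) × ∃[ c ] a Fin.≤ c × P c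

-- Abstract, so that indicators of decisions stay in a shape unification can solve.
abstract
  forces? : {P : Fin m → Set} → Decidable P → Decidable (Forces P)
  forces? P? a = Fin.all? (λ c → c Fin.<? a →-dec P? c)
           ×-dec Fin.any? (λ c → a Fin.≤? c ×-dec P? c)

-- The top face is exempt because lowering it may destroy the goal.
LowerClosed : (Fin (suc m) → Set) → Set
LowerClosed {m} P = ∀ {c d} → d Fin.< c → c ≢ fromℕ m → P c → P d

-- A lower closed set is an initial segment, possibly with the top face added;
-- the faces that force it are the initial segment of the same size.
sum-forces : {P : Fin (suc m) → Set} (P? : Decidable P) → LowerClosed P →
             sum (𝟙 ∘ forces? P?) ≡ sum (𝟙 ∘ P?)
sum-forces {zero} P? _ = cong (_+ 0) (𝟙-cong (forces? P? zero) (P? zero)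
  (λ { (_ , zero , _ , p) → p }) (λ p → (λ _ ()) , zero , z≤n , p))
sum-forces {suc m} {P} P? closed with P? zero
-- With 0 in `P`, face 0 forces `P`, and a nonzero face forces `P` iff it forces the restriction of
-- `P` to nonzero faces: induction on the number of faces.
... | yes p₀ = cong₂ _+_
  (𝟙-true (forces? P? zero) ((λ _ ()) , zero , z≤n , p₀))
  (trans
    (sum-cong-≗ λ a → 𝟙-cong (forces? P? (suc a)) (forces? (P? ∘ suc) a)
      (λ { (below , suc c , a≤c , p) →
           (λ c c<a → below (suc c) (s<s c<a)) , c , s≤s⁻¹ a≤c , p })
      (λ { (below , c , a≤c , p) →
           (λ { zero _ → p₀ ; (suc c) c<a → below c (s<s⁻¹ c<a) })
           , suc c , s≤s a≤c , p }))
    (sum-forces (P? ∘ suc) λ d<c c≢top →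
      closed (s<s d<c) (c≢top ∘ Fin.suc-injective)))
-- Without 0 in `P`, only the top face can lie in `P` and only face 0 can force it, so both counts
-- are the indicator of `P top`.
... | no ¬p₀ = begin
  𝟙 (forces? P? zero) + sum (λ a → 𝟙 (forces? P? (suc a)))
    ≡⟨ cong₂ _+_
         (𝟙-cong (forces? P? zero) (P? top)
           (λ { (_ , c , _ , p) → subst P (onlyTop p) p })
           (λ p → (λ _ ()) , top , z≤n , p))
         (sum-zero λ a → 𝟙-false (forces? P? (suc a))
           λ (below , _) → ¬p₀ (below zero z<s)) ⟩
  𝟙 (P? top) + 0
    ≡⟨ +-identityʳ _ ⟩
  𝟙 (P? top)
    ≡⟨ topCount (P? top) ⟩
  sum (λ c → 𝟙 (P? (suc c)))
    ∎
  where
  open ≡-Reasoning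
  top = fromℕ (suc m)
  onlyTop : ∀ {c} → P c → c ≡ top
  onlyTop {zero}  p = contradiction p ¬p₀
  onlyTop {suc c} p with suc c Fin.≟ top
  ... | yes eq = eq
  ... | no neq = contradiction (closed z<s neq p) ¬p₀
  topCount : (top? : Dec (P top)) → 𝟙 top? ≡ sum (λ c → 𝟙 (P? (suc c)))
  topCount (yes p) = sym (sum-point (fromℕ m)
    ( 𝟙-true (P? top) p
    , λ c c≢top → 𝟙-false (P? (suc c)) (c≢top ∘ Fin.suc-injective ∘ onlyTop)))
  topCount (no ¬p) = sym (sum-zero λ c →
    𝟙-false (P? (suc c)) λ p → ¬p (subst P (onlyTop p) p))

-- Counting all positions.

_≟ᵖ_ : (x y : Position m n) → Dec (x ≡ y)
_≟ᵖ_ = ≡-dec Fin._≟_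

count-all : {P : Position m n → Set} (P? : Decidable P) →
            (∀ x → P x) → count P? ≡ m ^ n
count-all {m} {n} P? all =
  trans (∑ᵖ-cong λ x → 𝟙-true (P? x) (all x)) (∑ᵖ-one m n)

-- The counts of a predicate and of its complement add up to `m ^ n`, so a full count leaves nothing
-- in the complement.
count-all⇒ : {P : Position m n → Set} (P? : Decidable P) →
             count P? ≡ m ^ n → ∀ x → P x
count-all⇒ {m} {n} {P} P? eq x = decidable-stable (P? x)
  (𝟙≡0⇒ (¬? (P? x)) (∑ᵖ≡0⇒ (λ x → 𝟙 (¬? (P? x))) none x))
  where
  none : ∑ᵖ (λ x → 𝟙 (¬? (P? x))) ≡ 0
  none = +-cancelˡ-≡ (count P?) _ _ (begin
    count P? + ∑ᵖ (λ x → 𝟙 (¬? (P? x)))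
      ≡⟨ ∑ᵖ-distrib-+ (𝟙 ∘ P?) (λ x → 𝟙 (¬? (P? x))) ⟨
    ∑ᵖ (λ x → 𝟙 (P? x) + 𝟙 (¬? (P? x)))
      ≡⟨ ∑ᵖ-cong (λ x → compl (P? x)) ⟩
    ∑ᵖ {m} {n} (λ _ → 1)
      ≡⟨ trans (∑ᵖ-one m n) (sym eq) ⟩
    count P?
      ≡⟨ +-identityʳ _ ⟨
    count P? + 0
      ∎)
    where
    open ≡-Reasoning
    compl : (a? : Dec A) → 𝟙 a? + 𝟙 (¬? a?) ≡ 1
    compl (yes _) = refl
    compl (no _)  = refl

-- Lowering dice that do not show the top face.

_⊑_ : Fin (suc m) → Fin (suc m) → Set
_⊑_ {m} a b = a Fin.≤ b × (b ≡ fromℕ m → a ≡ fromℕ m)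

_⊑ᵖ_ : Position (suc m) n → Position (suc m) n → Set
_⊑ᵖ_ = Pointwise _⊑_

⊑-refl : {a : Fin (suc m)} → a ⊑ a
⊑-refl = ≤-refl , id

⊑ᵖ-init : {x y : Position (suc m) (suc n)} → x ⊑ᵖ y → init x ⊑ᵖ init y
⊑ᵖ-init (_ ∷ [])             = []
⊑ᵖ-init (a⊑b ∷ x⊑y@(_ ∷ _)) = a⊑b ∷ ⊑ᵖ-init x⊑y

⊑ᵖ-last : {x y : Position (suc m) (suc n)} → x ⊑ᵖ y → last x ⊑ last y
⊑ᵖ-last (a⊑b ∷ [])         = a⊑b
⊑ᵖ-last (_ ∷ x⊑y@(_ ∷ _)) = ⊑ᵖ-last x⊑y

-- The second half of `⊑` forbids lowering a top face, and every die of the goal shows one.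
⊑ᵖ-goal : {x : Position (suc m) n} → x ⊑ᵖ goal → x ≡ goal
⊑ᵖ-goal []            = refl
⊑ᵖ-goal (a⊑b ∷ x⊑y) = cong₂ _∷_ (proj₂ a⊑b refl) (⊑ᵖ-goal x⊑y)

-- Prescribed leading dice followed by top faces.

pad : ∀ n → List (Fin (suc m)) → Position (suc m) n
pad zero    _       = []
pad (suc n) []      = fromℕ _ ∷ pad n []
pad (suc n) (c ∷ l) = c ∷ pad n l

pad-[] : ∀ n → pad {m} n [] ≡ goal
pad-[] zero    = refl
pad-[] (suc n) = cong (_ ∷_) (pad-[] n)

pad-toList : (x : Position (suc m) n) → pad n (toList x) ≡ x
pad-toList []      = refl
pad-toList (c ∷ x) = cong (c ∷_) (pad-toList x)

-- While some die is not prescribed, the last one shows the top face; this exposes it for a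
-- transfer.
pad-suc : ∀ n (l : List (Fin (suc m))) → List.length l ≤ n →
          pad (suc n) l ≡ pad n l ∷ʳ fromℕ m
pad-suc zero    []      _   = refl
pad-suc (suc n) []      _   = cong (_ ∷_) (pad-suc n [] z≤n)
pad-suc (suc n) (c ∷ l) l≤n = cong (c ∷_) (pad-suc n l (s≤s⁻¹ l≤n))

length-play : (σ : PrisonerStrategy m n) (τ : WardenStrategy m n)
              (β : Position m (suc n)) →
              ∀ t → List.length (tail (play σ τ β t)) ≡ t
length-play σ τ β zero    = refl
length-play σ τ β (suc t) = cong suc (length-play σ τ β t)

-- Winning positions and their monotonicity.

module Game (m n : ℕ) where

  Pos : Set
  Pos = Position (suc m) (suc n)

  N : ℕ
  N = suc m ^ suc n

  mutual
    -- `Winning k` is W k and `Reached k` is G k. Only `Reached` accepts the goal without a further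
    -- move, hence `Winning zero` is empty.
    Winning : ℕ → Pos → Set
    Winning zero    x = ⊥
    Winning (suc k) x = Forces (λ c → Reached k (transfer c x)) (last x)

    Reached : ℕ → Pos → Set
    Reached k x = x ≡ goal ⊎ Winning k x

  mutual
    winning? : ∀ k → Decidable (Winning k)
    winning? zero    x = no id
    winning? (suc k) x = forces? (λ c → reached? k (transfer c x)) (last x)

    reached? : ∀ k → Decidable (Reached k)
    reached? k x = x ≟ᵖ goal ⊎-dec winning? k x

  winning-suc : ∀ k {x : Pos} → Winning k x → Winning (suc k) x
  winning-suc (suc k) (below , c , a≤c , r) =
    (λ c c<a → up (below c c<a)) , c , a≤c , up r
    where
    up : ∀ {x} → Reached k x → Reached (suc k) x
    up (inj₁ eq) = inj₁ eq
    up (inj₂ w)  = inj₂ (winning-suc k w)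

  winning-mono : ∀ {k l} {x : Pos} → k ≤ l → Winning k x → Winning l x
  winning-mono k≤l w = go (≤⇒≤′ k≤l)
    where
    go : ∀ {l} → _ ≤′ l → Winning l _
    go ≤′-refl        = w
    go (≤′-step k≤′l) = winning-suc _ (go k≤′l)

  mutual
    -- Lowering the last die takes choices from the warden and gives choices to the prisoner; the
    -- other dice stay lowered after the same transfer.
    winning-⊑ᵖ : ∀ k {x y : Pos} → x ⊑ᵖ y → Winning k y → Winning k x
    winning-⊑ᵖ (suc k) x⊑y (below , c , b≤c , r) =
      let a≤b = proj₁ (⊑ᵖ-last x⊑y) in
      (λ c c<a → transfer-⊑ᵖ (below c (≤-trans c<a a≤b)))
      , c , ≤-trans a≤b b≤c , transfer-⊑ᵖ r
      where
      transfer-⊑ᵖ : ∀ {c} → Reached k (transfer c _) → Reached k (transfer c _)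
      transfer-⊑ᵖ = reached-⊑ᵖ k (⊑-refl ∷ ⊑ᵖ-init x⊑y)

    reached-⊑ᵖ : ∀ k {x y : Pos} → x ⊑ᵖ y → Reached k y → Reached k x
    reached-⊑ᵖ k x⊑y (inj₁ refl) = inj₁ (⊑ᵖ-goal x⊑y)
    reached-⊑ᵖ k x⊑y (inj₂ w)    = inj₂ (winning-⊑ᵖ k x⊑y w)

  -- Counting the winning positions.

  count-winning-suc : ∀ k → count (winning? (suc k)) ≡ count (reached? k)
  count-winning-suc k = begin
    ∑ᵖ (λ (x : Pos) → 𝟙 (winning? (suc k) x))
      ≡⟨ ∑ᵖ-∷ʳ {n = n} (λ x → 𝟙 (winning? (suc k) x)) ⟩
    ∑ᵖ {n = n} (λ w → sum λ a → 𝟙 (winning? (suc k) (w ∷ʳ a)))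
      -- Moves lead from `w ∷ʳ a` to `c ∷ w`, so for each `w` the winning `a` are the faces forcing
      -- the set of `c` with `c ∷ w` reached.
      ≡⟨ ∑ᵖ-cong {n = n}
           (λ w → trans (sum-cong-≗ (unfold w)) (sum-forces _ (closed w))) ⟩
    ∑ᵖ {n = n} (λ w → sum λ c → 𝟙 (reached? k (c ∷ w)))
      ≡⟨ sum-∑ᵖ-comm (λ c w → 𝟙 (reached? k (c ∷ w))) ⟨
    ∑ᵖ (λ (x : Pos) → 𝟙 (reached? k x))
      ∎
    where
    open ≡-Reasoning
    unfold : ∀ w a → 𝟙 (winning? (suc k) (w ∷ʳ a)) ≡
                     𝟙 (forces? (λ c → reached? k (c ∷ w)) a)
    unfold w a = cong₂ (λ v b → 𝟙 (forces? (λ c → reached? k (c ∷ v)) b))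
                       (init-∷ʳ a w) (last-∷ʳ a w)
    closed : ∀ w → LowerClosed (λ c → Reached k (c ∷ w))
    closed w d<c c≢top = reached-⊑ᵖ k
      ((<⇒≤ d<c , λ c≡top → contradiction c≡top c≢top)
       ∷ Pointwise.refl ⊑-refl)

  winning-top⇒reached : ∀ k (w : Position (suc m) n) →
    Winning (suc k) (w ∷ʳ fromℕ m) → ∀ c → Reached k (c ∷ w)
  winning-top⇒reached k w win c
    with below , d , top≤d , r ← subst₂ (λ v → Forces λ c → Reached k (c ∷ v))
                   (init-∷ʳ (fromℕ m) w) (last-∷ʳ (fromℕ m) w) win
    with c Fin.≟ fromℕ m
  -- The answer `d` to a pass is at least the top face, hence equal to it.
  ... | yes refl = subst (λ d → Reached k (d ∷ w))
                         (Fin.≤-antisym (Fin.≤fromℕ d) top≤d) r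
  ... | no c≢top = below c (Fin.≤∧≢⇒< (Fin.≤fromℕ c) c≢top)

  -- The positions of starting remoteness `suc k`.
  New : ℕ → Pos → Set
  New k x = Winning (suc k) x × ¬ Winning k x

  new? : ∀ k → Decidable (New k)
  new? k x = winning? (suc k) x ×-dec ¬? (winning? k x)

  count-new : ∀ k → count (winning? (suc k)) ≡
                    count (winning? k) + count (new? k)
  count-new k = trans
    (∑ᵖ-cong λ (x : Pos) → 𝟙-⊎ (winning? k x) (new? k x) (winning? (suc k) x)
      (λ w → case winning? k x of λ { (yes v) → inj₁ v ; (no ¬v) → inj₂ (w , ¬v) })
      (winning-suc k) proj₁ (λ w (_ , ¬w) → ¬w w))
    (∑ᵖ-distrib-+ (𝟙 ∘ winning? k) (𝟙 ∘ new? k))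

  -- If w(m-1) is winning then so is every cw, because the warden may choose any
  -- c < m-1 and otherwise leaves the prisoner only m-1. Hence the trailing
  -- (m-1)'s of a winning goal can be traded one by one for arbitrary leading dice.
  goal-winning⇒all : ∀ k → Winning k goal → ∀ x → Winning k x
  goal-winning⇒all k won x = subst (Winning k) (pad-toList x)
    (padded (toList x) (≤-reflexive (length-toList x)))
    where
    padded : ∀ l → List.length l ≤ suc n → Winning k (pad (suc n) l)
    padded []      _   = subst (Winning k) (sym (pad-[] (suc n))) won
    padded (c ∷ l) l≤n =
      -- If the transfer lands on the goal, `won` applies. Weakening to `suc k` beforehand pays for
      -- the move, so `k` is kept.
      [ (λ eq → subst (Winning k) (sym eq) won) , id ]′
        (winning-top⇒reached k (pad n l)
          (winning-suc k (subst (Winning k) (pad-suc n l (s≤s⁻¹ l≤n))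
            (padded l (m≤n⇒m≤1+n (s≤s⁻¹ l≤n)))))
          c)

  count-reached-suc : ∀ k → ¬ Winning k goal →
    count (reached? k) ≡ suc (count (winning? k))
  count-reached-suc k lost = begin
    count (reached? k)
      ≡⟨ ∑ᵖ-cong (λ (x : Pos) → 𝟙-⊎ (x ≟ᵖ goal) (winning? k x) (reached? k x)
           id inj₁ inj₂ λ { refl → lost }) ⟩
    ∑ᵖ (λ (x : Pos) → 𝟙 (x ≟ᵖ goal) + 𝟙 (winning? k x))
      ≡⟨ ∑ᵖ-distrib-+ (λ x → 𝟙 (x ≟ᵖ goal)) (𝟙 ∘ winning? k) ⟩
    ∑ᵖ (λ (x : Pos) → 𝟙 (x ≟ᵖ goal)) + count (winning? k)
      ≡⟨ cong (_+ count (winning? k)) (∑ᵖ-point {n = suc n} goal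
           ( 𝟙-true (_≟ᵖ_ {n = suc n} goal goal) refl
           , λ y → 𝟙-false (y ≟ᵖ goal))) ⟩
    suc (count (winning? k))
      ∎
    where open ≡-Reasoning

  -- Mutual induction with `goal-not-winning`: if the goal were winning for some `k < N`, all N
  -- positions would be, against the count `k`. So the goal is one extra element of `Reached k`,
  -- which has the size of the next winning set.
  count-winning : ∀ k → k ≤ N → count (winning? k) ≡ k
  goal-not-winning : ∀ k → k < N → ¬ Winning k goal

  count-winning zero _ = ∑ᵖ-zero {n = suc n} λ _ → refl
  count-winning (suc k) k<N =
    trans (count-winning-suc k)
    (trans (count-reached-suc k (goal-not-winning k k<N))
           (cong suc (count-winning k (<⇒≤ k<N))))

  goal-not-winning k k<N won = <⇒≢ k<N
    (trans (sym (count-winning k (<⇒≤ k<N)))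
           (count-all (winning? k) (goal-winning⇒all k won)))

  all-winning : ∀ (x : Pos) → Winning N x
  all-winning = count-all⇒ (winning? _) (count-winning _ ≤-refl)

  -- The winning sets are nested and their sizes at `k` and `suc k` differ by one.
  ∃!-new : ∀ k → k < N → ∃! _≡_ (New k)
  ∃!-new k k<N =
    let x , one , rest = ∑ᵖ≡1⇒ (𝟙 ∘ new? k) single
    in x , 𝟙≡1⇒ (new? k x) one , λ {y} new →
         decidable-stable (x ≟ᵖ y) λ x≢y →
           𝟙≡0⇒ (new? k y) (rest y (x≢y ∘ sym)) new
    where
    single : count (new? k) ≡ 1
    single = +-cancelˡ-≡ k _ _ (begin
      k + count (new? k)
        ≡⟨ cong (_+ count (new? k)) (count-winning k (<⇒≤ k<N)) ⟨
      count (winning? k) + count (new? k)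
        ≡⟨ count-new k ⟨
      count (winning? (suc k))
        ≡⟨ count-winning (suc k) k<N ⟩
      suc k
        ≡⟨ +-comm 1 k ⟩
      k + 1
        ∎)
      where open ≡-Reasoning

  -- Optimal strategies with `d` moves left.

  prisonerReply : ∀ (d : ℕ) (x : Pos) → PrisonerChoice x
  prisonerReply zero    x = last x , ≤-refl
  prisonerReply (suc d) x with winning? (suc d) x
  ... | yes (_ , c , a≤c , _) = c , a≤c
  -- An unchanged die is always a legal default.
  ... | no _                  = last x , ≤-refl

  step-prisonerReply : ∀ (d : ℕ) (x : Pos) → Winning (suc d) x →
    (w : WardenChoice x) → Reached d (step x w (prisonerReply (suc d) x))
  step-prisonerReply d x win (decrease c c<a) = proj₁ win c c<a
  step-prisonerReply d x win pass with winning? (suc d) x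
  ... | yes (_ , _ , _ , r) = r
  ... | no ¬win             = contradiction win ¬win

  -- Decrease to escape `Reached d` if possible. Otherwise the first half of `Forces` holds, so in a
  -- position that is not winning the second half fails and passing is safe.
  wardenReply : ∀ (d : ℕ) (x : Pos) → WardenChoice x
  wardenReply zero    x = pass
  wardenReply (suc d) x
    with Fin.any? (λ c → c Fin.<? last x ×-dec ¬? (reached? d (transfer c x)))
  ... | yes (c , c<a , _) = decrease c c<a
  ... | no _              = pass

  step-wardenReply : ∀ (d : ℕ) (x : Pos) → ¬ Winning (suc d) x →
    (p : PrisonerChoice x) → ¬ Reached d (step x (wardenReply (suc d) x) p)
  step-wardenReply d x lost (c , a≤c)
    with Fin.any? (λ c → c Fin.<? last x ×-dec ¬? (reached? d (transfer c x)))
  ... | yes (_ , _ , ¬r) = ¬r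
  ... | no none = λ r → lost
    ( (λ b b<a → decidable-stable (reached? d (transfer b x))
        λ ¬r → none (b , b<a , ¬r))
    , c , a≤c , r)

  module _ (k : ℕ) (β : Pos) where

    -- A history includes the starting position, so its tail has as many entries as moves were made.
    movesLeft : History (suc m) (suc n) → ℕ
    movesLeft h = k ∸ List.length (tail h)

    movesLeft-play : ∀ σ τ t {d} → t + d ≡ k → d ≡ movesLeft (play σ τ β t)
    movesLeft-play σ τ t {d} refl =
      sym (trans (cong (k ∸_) (length-play σ τ β t)) (m+n∸m≡n t d))

    winning⇒winsWithin : Winning k β → WinsWithin k β
    winning⇒winsWithin win = σ , λ τ → finish τ k 0 refl win
      where
      σ : PrisonerStrategy (suc m) n
      σ h = prisonerReply (movesLeft h) (head h)

      -- The strict `t < s` makes the play leave its start even if that is the goal.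
      finish : ∀ τ d t → t + d ≡ k → Winning d (head (play σ τ β t)) →
               ∃[ s ] t < s × s ≤ k × head (play σ τ β s) ≡ goal
      finish τ (suc d) t eq w =
        case subst (λ e → Reached d (step x (τ h) (prisonerReply e x)))
               (movesLeft-play σ τ t eq)
               (step-prisonerReply d x w (τ h)) of λ where
          (inj₁ x≡goal) →
            suc t , ≤-refl , m+n≤o⇒m≤o (suc t) (≤-reflexive eq′) , x≡goal
          (inj₂ w′) →
            let s , t<s , rest = finish τ d (suc t) eq′ w′
            in s , <⇒≤ t<s , rest
        where
        h   = play σ τ β t
        x   = head h
        eq′ = trans (sym (+-suc t d)) eq

    -- By contraposition: from a position that is not winning, the warden's replies hold off any
    -- prisoner strategy for `k` moves.
    winsWithin⇒winning : WinsWithin k β → Winning k β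
    winsWithin⇒winning (σ , wins) = decidable-stable (winning? k β) λ lost →
      let t , 0<t , t≤k , eq = wins τ
      in proj₂ (delayed lost t (k ∸ t) (m+[n∸m]≡n t≤k)) 0<t eq
      where
      τ : WardenStrategy (suc m) n
      τ h = wardenReply (movesLeft h) (head h)

      delayed : ¬ Winning k β → ∀ t d → t + d ≡ k →
                ¬ Winning d (head (play σ τ β t)) ×
                (0 < t → head (play σ τ β t) ≢ goal)
      -- The start may be the goal; only visits after at least one move are excluded.
      delayed lost zero    d refl = lost , λ ()
      delayed lost (suc t) d eq   = ¬r ∘ inj₂ , λ _ → ¬r ∘ inj₁
        where
        h   = play σ τ β t
        x   = head h
        eq′ = trans (+-suc t d) eq
        ¬r  = subst (λ e → ¬ Reached d (step x (wardenReply e x) (σ h)))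
                (movesLeft-play σ τ t eq′)
                (step-wardenReply d x (proj₁ (delayed lost t (suc d) eq′)) (σ h))

  -- From winning sets to remoteness.

  new⇒startRemoteness : ∀ {k} {β : Pos} → New k β → StartRemoteness β (suc k)
  new⇒startRemoteness {k = k} {β} (win , lost) = record
    { positive = z<s
    ; wins     = winning⇒winsWithin (suc k) β win
    ; least    = λ l _ wins → ≰⇒> λ l≤k →
        lost (winning-mono l≤k (winsWithin⇒winning l β wins))
    }

  startRemoteness⇒new : ∀ {k} {β : Pos} → StartRemoteness β (suc k) → New k β
  startRemoteness⇒new {k = k} {β} r =
    winsWithin⇒winning (suc k) β wins , lost k least
    where
    open StartRemoteness r
    -- `least` speaks of positive bounds only, hence the split on `k`; in zero moves nothing is
    -- winning.
    lost : ∀ k → (∀ l → 1 ≤ l → WinsWithin l β → suc k ≤ l) → ¬ Winning k β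
    lost (suc k) least w =
      1+n≰n (least (suc k) z<s (winning⇒winsWithin (suc k) β w))

theorem4 : (m n : ℕ) →
    (∀ j → j ≤ suc m ^ suc n →
    ∃! _≡_ (λ (β : Position (suc m) (suc n)) → Remoteness β j))
    × (∀ (β : Position (suc m) (suc n)) j → Remoteness β j → j ≤ suc m ^ suc n)
    × StartRemoteness (goal {m} {suc n}) (suc m ^ suc n)
theorem4 m n = unique , bounded , largest
  where
  open Game m n
  0<N : 0 < N
  0<N = m^n>0 (suc m) (suc n)

  unique : ∀ j → j ≤ N → ∃! _≡_ (λ (β : Position (suc m) (suc n)) → Remoteness β j)
  unique zero _ = goal , ending , λ where
    ending       → refl
    (starting r) → contradiction (StartRemoteness.positive r) λ ()
  unique (suc k) k<N =
    let β , new , uniq = ∃!-new k k<N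
    in β , starting (new⇒startRemoteness new) ,
       λ { (starting r) → uniq (startRemoteness⇒new r) }

  bounded : ∀ (β : Position (suc m) (suc n)) j → Remoteness β j → j ≤ N
  bounded β _ ending       = z≤n
  bounded β j (starting r) =
    StartRemoteness.least r N 0<N (winning⇒winsWithin N β (all-winning β))

  largest : StartRemoteness (goal {m} {suc n}) N
  largest = record
    { positive = 0<N
    ; wins     = winning⇒winsWithin N goal (all-winning goal)
    ; least    = λ l _ wins → ≮⇒≥ λ l<N →
        goal-not-winning l l<N (winsWithin⇒winning l goal wins)
    }
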